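{- Let $a_0,a_1,\alpha,\beta,u,v\in\mathbb{R}$ with $\alpha\beta\neq 0$, $uv\neq 0$ and $|a_0|+|a_1|\neq 0$, and let $(a_{n,k})_{0\le k\le n}$ be the binary binomial interpolated triangle with parameters $(a_0,a_1,\alpha,\beta;u,v)$ (so $a_{0,0}=a_0$, $a_{1,0}=a_1$). Let $\mathcal{A}=u\alpha+2v$ and $D=\sqrt{\alpha^2+4\beta}$. (1) If $D\ne0$, then, with $x_1=(\alpha+D)/2$ and $x_2=(\alpha-D)/2$, for all $n\ge 1$ and $0\le k\le n$, $$a_{n,k}= \frac{(vD+\alpha v-2\beta u)a_{n,0}+2\beta a_{n,1}}{2 vD}\left(\frac{\beta u-vx_2}{\beta}\right)^k + \frac{(vD-\alpha v +2\beta u)a_{n,0}-2\beta a_{n,1}}{2 vD}\left(\frac{\beta u-vx_1}{\beta}\right)^k,$$ where $$a_{n,0} = \frac{(D-\alpha)a_{0,0}+2a_{1,0}}{2D}x_1^n+ \frac{(D+\alpha)a_{0,0}-2a_{1,0}}{2D}x_2^n\quad(n\ge 0),$$ $$a_{n,1} = \frac{(D-\alpha)a_{0,0}+2a_{1,0}}{2D}x_1^{n-1}(ux_1+v)+ \frac{(D+\alpha)a_{0,0}-2a_{1,0}}{2D}x_2^{n-1}(ux_2+v)\quad(n\ge 1).$$ (2) If $D=0$ and $\mathcal{A}\ne0$, then for all $n\ge 1$ and $0\le k\le n$, $$a_{n,k}= \left( a_{n,0}+k\left(\frac{\alpha a_{n,1}}{\mathcal{A}} -a_{n,0} \right) \right)\left(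 \frac{\mathcal{A}}{\alpha}\right)^k,$$ where $$a_{n,0} = \left(a_{0,0}+n\frac{2a_{1,0}-\alpha a_{0,0}}{\alpha } \right) \left( \frac{\alpha}{2}\right)^n\quad(n\ge 0),$$ $$a_{n,1} = u\,a_{n,0}+v \left(a_{0,0}+(n-1)\frac{2a_{1,0}-\alpha a_{0,0}}{\alpha } \right) \left( \frac{\alpha}{2}\right)^{n-1}\quad(n\ge 1).$$ (3) If $D=0$ and $\mathcal{A}=0$, then $$a_{n,0} = \left(a_{0,0}+n\frac{2a_{1,0}-\alpha a_{0,0}}{\alpha } \right) \left( \frac{\alpha}{2}\right)^n\quad(n\ge 0),\qquad a_{n,1} = u\,\frac{2a_{1,0}-\alpha a_{0,0}}{\alpha }\left( \frac{\alpha}{2}\right)^{n}\quad(n\ge 1),$$ and $a_{n,k}=0$ for all $2\le k\le n$.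
   Context: The binary binomial interpolated triangle with parameters $(a_0,a_1,\alpha,\beta;u,v)$ is the array of real numbers $a_{n,k}$ ($0\le k\le n$) defined as follows. Its left diagonal is $a_{n,0}=a_n$, where $(a_n)_{n\ge0}$ has initial values $a_0,a_1$ and satisfies $a_n=\alpha a_{n-1}+\beta a_{n-2}$ for $n\ge 2$. The other entries are given by $a_{n,k}=u\,a_{n,k-1}+v\,a_{n-1,k-1}$ for $1\le k\le n$. The number $D$ denotes a square root of $\alpha^2+4\beta$, which is complex if $\alpha^2+4\beta<0$; the convention $z^0=1$ (also for $z=0$) is used. -}

module Defs where

open import Level using (Level) renaming (suc to lsuc; _⊔_ to _⊔ˡ_)
open import Algebra.Bundles using (CommutativeRing)
open import Algebra.Apartness.Bundles using (HeytingField; HeytingCommutativeRing)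
import Algebra.Apartness.Properties.HeytingCommutativeRing as HeytingProperties
import Algebra.Properties.Semiring.Exp as Exponentiation
import Algebra.Properties.Semiring.Mult as Multiplication
import Algebra.Properties.Ring as RingProperties
import Algebra.Solver.Ring.NaturalCoefficients.Default as SemiringSolver
open import Algebra.Structures using (IsAbelianGroup; IsCommutativeRing)
open import Algebra.Apartness.Structures using (IsHeytingField)
open import Algebra.Consequences.Setoid using (comm∧idˡ⇒idʳ; comm∧distrˡ⇒distrʳ)
open import Data.Nat.Base as ℕ using (ℕ; zero; suc; s≤s⁻¹)
import Data.Nat.Properties as ℕ
open import Data.Product.Base using (∃; _×_; _,_; proj₁; proj₂)
open import Data.Sum.Base using (_⊎_; inj₁; inj₂; [_,_]′)
import Data.Sum.Base as Sum
open import Function.Base using (_∘_)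
open import Function.Bundles using (_⇔_; module Equivalence)
open import Relation.Binary.Core using (Rel)
open import Relation.Binary.Lattice.Definitions using (Supremum)
open import Relation.Binary.Structures using (IsStrictPartialOrder)
open import Relation.Nullary.Negation using (¬_)
import Relation.Binary.Reasoning.Setoid as SetoidReasoning

private variable
  c ℓ₁ ℓ₂ : Level

module FieldArithmetic (F : HeytingField c ℓ₁ ℓ₂) where

  open HeytingField F
  open HeytingProperties heytingCommutativeRing
  open HeytingCommutativeRing heytingCommutativeRing public using (commutativeRing)
  open CommutativeRing commutativeRing using (semiring)
  open Exponentiation semiring public using (_^_)
  open Multiplication semiring using () renaming (_×_ to _×ⁿ_)

  fromℕ : ℕ → Carrier
  fromℕ n = n ×ⁿ 1#

  2# 4# : Carrier
  2# = fromℕ 2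
  4# = fromℕ 4

  inv : ∀ y → y # 0# → Carrier
  inv y y#0 = proj₁ (#⇒invertible y#0)

  infixl 7 _÷_[_]

  _÷_[_] : Carrier → ∀ y → y # 0# → Carrier
  x ÷ y [ y#0 ] = x * inv y y#0

  inv-inverseˡ : ∀ y (y#0 : y # 0#) → inv y y#0 * y ≈ 1#
  inv-inverseˡ y y#0 =
    trans (*-congˡ (sym (x-0≈x y))) (proj₁ (proj₂ (#⇒invertible y#0)))

  *≈1⇒#0 : ∀ {x y} → x * y ≈ 1# → y # 0#
  *≈1⇒#0 {x} {y} xy≈1 = invertibleˡ⇒# (x , trans (*-congˡ (x-0≈x y)) xy≈1)

  *#0⇒ʳ#0 : ∀ {x y} → x * y # 0# → y # 0#
  *#0⇒ʳ#0 {x} {y} xy#0 =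
    *≈1⇒#0 (trans (*-assoc _ x y) (inv-inverseˡ (x * y) xy#0))

  *#0⇒ˡ#0 : ∀ {x y} → x * y # 0# → x # 0#
  *#0⇒ˡ#0 {x} {y} xy#0 = *#0⇒ʳ#0 (#-congʳ (*-comm x y) xy#0)

  *#0 : ∀ {x y} → x # 0# → y # 0# → x * y # 0#
  *#0 = x#0y#0→xy#0

  -#0⇒# : ∀ {x y} → x - y # 0# → x # y
  -#0⇒# {x} {y} p = invertibleˡ⇒# (inv (x - y) p , inv-inverseˡ (x - y) p)

  #⇒-#0 : ∀ {x y} → x # y → x - y # 0#
  #⇒-#0 x#y = *≈1⇒#0 (proj₁ (proj₂ (#⇒invertible x#y)))

  +#0 : ∀ {x y} → x + y # 0# → x # 0# ⊎ y # 0#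
  +#0 {x} {y} p = Sum.map₁ (#-congʳ x+y-y≈x ∘ #⇒-#0) (#-cotrans p y)
    where
    x+y-y≈x : x + y - y ≈ x
    x+y-y≈x = trans (+-assoc x y (- y))
                    (trans (+-congˡ (-‿inverseʳ y)) (+-identityʳ x))

-- An Archimedean, Cauchy complete ordered field: classically this
-- determines ℝ up to isomorphism.  Constructively, x # 0# is the meaning
-- of x ≠ 0, and Bishop's reals satisfy all the axioms.

record RealNumbers c ℓ₁ ℓ₂ : Set (lsuc (c ⊔ˡ ℓ₁ ⊔ˡ ℓ₂)) where

  field
    heytingField : HeytingField c ℓ₁ ℓ₂

  open HeytingField heytingField public
  open FieldArithmetic heytingField public

  infix 4 _<_ _≤_
  infixl 6 _⊔_

  field
    _<_                    : Rel Carrier ℓ₂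
    <-isStrictPartialOrder : IsStrictPartialOrder _≈_ _<_
    #⇔<⊎>                  : ∀ {x y} → x # y ⇔ (x < y ⊎ y < x)
    +-monoˡ-<              : ∀ z {x y} → x < y → x + z < y + z
    *-pos                  : ∀ {x y} → 0# < x → 0# < y → 0# < x * y

  _≤_ : Rel Carrier ℓ₂
  x ≤ y = ¬ (y < x)

  field
    _⊔_        : Carrier → Carrier → Carrier
    ⊔-supremum : Supremum _≤_ _⊔_

  ∣_∣ : Carrier → Carrier
  ∣ x ∣ = x ⊔ (- x)

  IsCauchy : (ℕ → Carrier) → Set (c ⊔ˡ ℓ₂)
  IsCauchy s = ∀ ε → 0# < ε →
    ∃ λ N → ∀ m n → N ℕ.≤ m → N ℕ.≤ n → ∣ s m - s n ∣ < ε

  _ConvergesTo_ : (ℕ → Carrier) → Carrier → Set (c ⊔ˡ ℓ₂)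
  s ConvergesTo x = ∀ ε → 0# < ε →
    ∃ λ N → ∀ n → N ℕ.≤ n → ∣ s n - x ∣ < ε

  field
    archimedean : ∀ x → ∃ λ n → x < fromℕ n
    complete    : ∀ s → IsCauchy s → ∃ (s ConvergesTo_)

  open IsStrictPartialOrder <-isStrictPartialOrder public
    using (<-respˡ-≈; <-respʳ-≈) renaming (irrefl to <-irrefl; trans to <-trans)

record Pair (A : Set c) : Set c where
  constructor _+i_
  field
    re im : A

module Complex (R : RealNumbers c ℓ₁ ℓ₂) where

  open RealNumbers R
  open HeytingProperties heytingCommutativeRing using (#-congʳ; 1#0)
  open CommutativeRing commutativeRing using (ring; commutativeSemiring)
  open RingProperties ring
    using (-0#≈0#; -1*x≈-x; -‿distribˡ-*; -‿distribʳ-*; -‿involutive)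
  open SemiringSolver commutativeSemiring using (solve; _:=_; _:+_; _:*_)
  open Pair

  Carrierᶜ : Set _
  Carrierᶜ = Pair Carrier

  infix  8 -ᶜ_
  infixl 7 _*ᶜ_
  infixl 6 _+ᶜ_
  infix  4 _≈ᶜ_ _#ᶜ_

  _≈ᶜ_ _#ᶜ_ : Rel Carrierᶜ _
  z ≈ᶜ w = re z ≈ re w × im z ≈ im w
  z #ᶜ w = re z # re w ⊎ im z # im w

  _+ᶜ_ _*ᶜ_ : Carrierᶜ → Carrierᶜ → Carrierᶜ
  z +ᶜ w = (re z + re w) +i (im z + im w)
  z *ᶜ w = (re z * re w - im z * im w) +i (re z * im w + im z * re w)

  -ᶜ_ : Carrierᶜ → Carrierᶜ
  -ᶜ z = (- re z) +i (- im z)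

  ι : Carrier → Carrierᶜ
  ι x = x +i 0#

  private

    -- The semiring solver cannot see negation, so it is fed j = - 1#.
    j : Carrier
    j = - 1#

    -→j : ∀ x y → x - y ≈ x + j * y
    -→j x y = +-congˡ (sym (-1*x≈-x y))

    isAbelianGroupᶜ : IsAbelianGroup _≈ᶜ_ _+ᶜ_ (ι 0#) -ᶜ_
    isAbelianGroupᶜ = record
      { isGroup = record
        { isMonoid = record
          { isSemigroup = record
            { isMagma = record
              { isEquivalence = record
                { refl  = refl , refl
                ; sym   = λ (p , q) → sym p , sym q
                ; trans = λ (p , q) (r , s) → trans p r , trans q s
                }
              ; ∙-cong = λ (p , q) (r , s) → +-cong p r , +-cong q s
              }
            ; assoc = λ _ _ _ → +-assoc _ _ _ , +-assoc _ _ _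
            }
          ; identity = (λ _ → +-identityˡ _ , +-identityˡ _)
                     , (λ _ → +-identityʳ _ , +-identityʳ _)
          }
        ; inverse = (λ _ → -‿inverseˡ _ , -‿inverseˡ _)
                  , (λ _ → -‿inverseʳ _ , -‿inverseʳ _)
        ; ⁻¹-cong = λ (p , q) → -‿cong p , -‿cong q
        }
      ; comm = λ _ _ → +-comm _ _ , +-comm _ _
      }

    *ᶜ-cong : ∀ {x y z w} → x ≈ᶜ y → z ≈ᶜ w → x *ᶜ z ≈ᶜ y *ᶜ w
    *ᶜ-cong (p , q) (r , s) =
      +-cong (*-cong p r) (-‿cong (*-cong q s)) , +-cong (*-cong p s) (*-cong q r)

    *ᶜ-comm : ∀ z w → z *ᶜ w ≈ᶜ w *ᶜ z
    *ᶜ-comm (a +i b) (x +i y) =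
      +-cong (*-comm a x) (-‿cong (*-comm b y)) ,
      trans (+-comm (a * y) (b * x)) (+-cong (*-comm b x) (*-comm a y))

    *ᶜ-assoc : ∀ z w t → (z *ᶜ w) *ᶜ t ≈ᶜ z *ᶜ (w *ᶜ t)
    *ᶜ-assoc (a +i b) (x +i y) (p +i q) =
      (begin
        (a * x - b * y) * p - (a * y + b * x) * q
          ≈⟨ -→j _ _ ⟩
        (a * x - b * y) * p + j * ((a * y + b * x) * q)
          ≈⟨ +-congʳ (*-congʳ (-→j _ _)) ⟩
        (a * x + j * (b * y)) * p + j * ((a * y + b * x) * q)
          ≈⟨ solve 7 (λ a b x y p q j →
               (a :* x :+ j :* (b :* y)) :* p :+ j :* ((a :* y :+ b :* x) :* q) :=
               a :* (x :* p :+ j :* (y :* q)) :+ j :* (b :* (x :* q :+ y :* p)))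
               refl a b x y p q j ⟩
        a * (x * p + j * (y * q)) + j * (b * (x * q + y * p))
          ≈⟨ +-congʳ (*-congˡ (-→j _ _)) ⟨
        a * (x * p - y * q) + j * (b * (x * q + y * p))
          ≈⟨ -→j _ _ ⟨
        a * (x * p - y * q) - b * (x * q + y * p) ∎) ,
      (begin
        (a * x - b * y) * q + (a * y + b * x) * p
          ≈⟨ +-congʳ (*-congʳ (-→j _ _)) ⟩
        (a * x + j * (b * y)) * q + (a * y + b * x) * p
          ≈⟨ solve 7 (λ a b x y p q j →
               (a :* x :+ j :* (b :* y)) :* q :+ (a :* y :+ b :* x) :* p :=
               a :* (x :* q :+ y :* p) :+ b :* (x :* p :+ j :* (y :* q)))
               refl a b x y p q j ⟩
        a * (x * q + y * p) + b * (x * p + j * (y * q))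
          ≈⟨ +-congˡ (*-congˡ (-→j _ _)) ⟨
        a * (x * q + y * p) + b * (x * p - y * q) ∎)
      where open SetoidReasoning (CommutativeRing.setoid commutativeRing)

    *ᶜ-identityˡ : ∀ z → ι 1# *ᶜ z ≈ᶜ z
    *ᶜ-identityˡ (a +i b) =
      trans (+-cong (*-identityˡ a) (trans (-‿cong (zeroˡ b)) -0#≈0#))
            (+-identityʳ a) ,
      trans (+-cong (*-identityˡ b) (zeroˡ a)) (+-identityʳ b)

    *ᶜ-distribˡ : ∀ z w t → z *ᶜ (w +ᶜ t) ≈ᶜ z *ᶜ w +ᶜ z *ᶜ t
    *ᶜ-distribˡ (a +i b) (x +i y) (p +i q) =
      (begin
        a * (x + p) - b * (y + q)
          ≈⟨ -→j _ _ ⟩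
        a * (x + p) + j * (b * (y + q))
          ≈⟨ solve 7 (λ a b x y p q j →
               a :* (x :+ p) :+ j :* (b :* (y :+ q)) :=
               (a :* x :+ j :* (b :* y)) :+ (a :* p :+ j :* (b :* q)))
               refl a b x y p q j ⟩
        (a * x + j * (b * y)) + (a * p + j * (b * q))
          ≈⟨ +-cong (-→j _ _) (-→j _ _) ⟨
        (a * x - b * y) + (a * p - b * q) ∎) ,
      solve 6 (λ a b x y p q →
        a :* (y :+ q) :+ b :* (x :+ p) :=
        (a :* y :+ b :* x) :+ (a :* q :+ b :* p))
        refl a b x y p q
      where open SetoidReasoning (CommutativeRing.setoid commutativeRing)

    isCommutativeRingᶜ : IsCommutativeRing _≈ᶜ_ _+ᶜ_ _*ᶜ_ -ᶜ_ (ι 0#) (ι 1#)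
    isCommutativeRingᶜ = record
      { isRing = record
        { +-isAbelianGroup = isAbelianGroupᶜ
        ; *-cong     = *ᶜ-cong
        ; *-assoc    = *ᶜ-assoc
        ; *-identity = *ᶜ-identityˡ
                     , comm∧idˡ⇒idʳ setoidᶜ *ᶜ-comm *ᶜ-identityˡ
        ; distrib    = *ᶜ-distribˡ
                     , comm∧distrˡ⇒distrʳ setoidᶜ
                         (λ (p , q) (r , s) → +-cong p r , +-cong q s)
                         *ᶜ-comm *ᶜ-distribˡ
        }
      ; *-comm = *ᶜ-comm
      }
      where
      setoidᶜ = record { isEquivalence = IsAbelianGroup.isEquivalence isAbelianGroupᶜ }

    square-pos : ∀ {x} → x # 0# → 0# < x * x
    square-pos {x} x#0 with Equivalence.to #⇔<⊎> x#0
    ... | inj₂ 0<x = *-pos 0<x 0<x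
    ... | inj₁ x<0 = <-respʳ-≈ [-x][-x]≈xx (*-pos 0<-x 0<-x)
      where
      0<-x : 0# < - x
      0<-x = <-respˡ-≈ (-‿inverseʳ x)
               (<-respʳ-≈ (+-identityˡ (- x)) (+-monoˡ-< (- x) x<0))
      [-x][-x]≈xx : - x * - x ≈ x * x
      [-x][-x]≈xx = trans (sym (-‿distribˡ-* x (- x)))
        (trans (-‿cong (sym (-‿distribʳ-* x x))) (-‿involutive (x * x)))

    sum-of-squares#0ˡ : ∀ {x} y → x # 0# → x * x + y * y # 0#
    sum-of-squares#0ˡ {x} y x#0 =
      [ (λ x²#S → y#0⇒S#0 (*#0⇒ˡ#0 (y²#0 x²#S)))
      , (λ S#0 → S#0)
      ]′ (#-cotrans (*#0 x#0 x#0) (x * x + y * y))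
      where
      y²#0 : x * x # x * x + y * y → y * y # 0#
      y²#0 x²#S = #-congʳ
        (begin
          x * x + y * y - x * x   ≈⟨ +-congʳ (+-comm _ _) ⟩
          y * y + x * x - x * x   ≈⟨ +-assoc _ _ _ ⟩
          y * y + (x * x - x * x) ≈⟨ +-congˡ (-‿inverseʳ _) ⟩
          y * y + 0#              ≈⟨ +-identityʳ _ ⟩
          y * y                   ∎)
        (#⇒-#0 (#-sym x²#S))
        where open SetoidReasoning (CommutativeRing.setoid commutativeRing)
      y#0⇒S#0 : y # 0# → x * x + y * y # 0#
      y#0⇒S#0 y#0 = Equivalence.from #⇔<⊎> (inj₂
        (<-trans (square-pos y#0)
          (<-respˡ-≈ (+-identityˡ (y * y))
            (+-monoˡ-< (y * y) (square-pos x#0)))))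

    ∣_∣² : Carrierᶜ → Carrier
    ∣ z ∣² = re z * re z + im z * im z

    ∣∣²#0 : ∀ z → re z # 0# ⊎ im z # 0# → ∣ z ∣² # 0#
    ∣∣²#0 z (inj₁ p) = sum-of-squares#0ˡ (im z) p
    ∣∣²#0 z (inj₂ p) = #-congʳ (+-comm _ _) (sum-of-squares#0ˡ (re z) p)

    invᶜ : ∀ z → ∣ z ∣² # 0# → ∃ λ w → w *ᶜ z ≈ᶜ ι 1#
    invᶜ z@(a +i b) p = (n * a) +i (- (n * b)) ,
      (begin
        (n * a) * a - (- (n * b)) * b   ≈⟨ +-congˡ (-‿cong (-‿distribˡ-* _ _)) ⟨
        (n * a) * a - (- (n * b * b))   ≈⟨ +-congˡ (-‿involutive _) ⟩
        (n * a) * a + (n * b) * b       ≈⟨ +-cong (*-assoc _ _ _) (*-assoc _ _ _) ⟩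
        n * (a * a) + n * (b * b)       ≈⟨ distribˡ _ _ _ ⟨
        n * ∣ z ∣²                      ≈⟨ inv-inverseˡ _ p ⟩
        1#                              ∎) ,
      (begin
        (n * a) * b + (- (n * b)) * a   ≈⟨ +-congˡ (-‿distribˡ-* _ _) ⟨
        (n * a) * b - (n * b) * a       ≈⟨ +-congˡ (-‿cong
                                             (solve 3 (λ n a b →
                                               (n :* b) :* a := (n :* a) :* b)
                                               refl n a b)) ⟩
        (n * a) * b - (n * a) * b       ≈⟨ -‿inverseʳ _ ⟩
        0#                              ∎)
      where
      open SetoidReasoning (CommutativeRing.setoid commutativeRing)
      n = inv ∣ z ∣² p

    *ᶜ≈1⇒#0 : ∀ w z → w *ᶜ z ≈ᶜ ι 1# → re z # 0# ⊎ im z # 0#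
    *ᶜ≈1⇒#0 w z (p , _) = Sum.map *#0⇒ʳ#0 (*#0⇒ʳ#0 ∘ -#0)
      (+#0 (#-congʳ (sym p) 1#0))
      where
      -#0 : ∀ {x} → - x # 0# → x # 0#
      -#0 q = *#0⇒ʳ#0 (#-congʳ (sym (-1*x≈-x _)) q)

    isHeytingFieldᶜ :
      IsHeytingField _≈ᶜ_ _#ᶜ_ _+ᶜ_ _*ᶜ_ -ᶜ_ (ι 0#) (ι 1#)
    isHeytingFieldᶜ = record
      { isHeytingCommutativeRing = record
        { isCommutativeRing   = isCommutativeRingᶜ
        ; isApartnessRelation = record
          { irrefl  = λ (p , q) → [ #-irrefl p , #-irrefl q ]′
          ; sym     = Sum.map #-sym #-sym
          ; cotrans = λ where
              (inj₁ p) z → Sum.map inj₁ inj₁ (#-cotrans p (re z))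
              (inj₂ p) z → Sum.map inj₂ inj₂ (#-cotrans p (im z))
          }
        ; #⇒invertible = λ {x} {y} x#y →
            let z = x +ᶜ -ᶜ y
                (w , wz≈1) = invᶜ z (∣∣²#0 z (Sum.map #⇒-#0 #⇒-#0 x#y))
            in w , wz≈1 ,
               IsCommutativeRing.trans isCommutativeRingᶜ (*ᶜ-comm z w) wz≈1
        ; invertible⇒# = λ (w , wz≈1 , _) → Sum.map -#0⇒# -#0⇒# (*ᶜ≈1⇒#0 w _ wz≈1)
        }
      ; tight = λ z w →
          (λ ¬z#w → proj₁ (tight _ _) (¬z#w ∘ inj₁)
                  , proj₁ (tight _ _) (¬z#w ∘ inj₂)) ,
          (λ (p , q) → [ #-irrefl p , #-irrefl q ]′)
      }

  complexField : HeytingField _ _ _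
  complexField = record { isHeytingField = isHeytingFieldᶜ }

  module ℂ where
    open HeytingField complexField public
    open FieldArithmetic complexField public

  2#0 : 2# # 0#
  2#0 = Equivalence.from #⇔<⊎> (inj₂
    (<-trans 0<1 (<-respˡ-≈ (+-identityˡ 1#)
      (<-respʳ-≈ (+-congˡ (sym (+-identityʳ 1#))) (+-monoˡ-< 1# 0<1)))))
    where
    0<1 : 0# < 1#
    0<1 = <-respʳ-≈ (*-identityˡ 1#) (square-pos 1#0)

  2ᶜ#0 : ℂ.2# ℂ.# ℂ.0#
  2ᶜ#0 = inj₁ 2#0

  ι-#0 : ∀ {x} → x # 0# → ι x ℂ.# ℂ.0#
  ι-#0 = inj₁

module Triangle (R : RealNumbers c ℓ₁ ℓ₂)
                (a₀ a₁ α β u v : RealNumbers.Carrier R) where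

  open RealNumbers R using (Carrier; _+_; _*_)

  diagonal : ℕ → Carrier
  diagonal zero          = a₀
  diagonal (suc zero)    = a₁
  diagonal (suc (suc n)) = α * diagonal (suc n) + β * diagonal n

  entry : ∀ n k → .(k ℕ.≤ n) → Carrier
  entry n       zero    _   = diagonal n
  entry zero    (suc k) ()
  entry (suc n) (suc k) k<n =
    u * entry (suc n) k (ℕ.<⇒≤ k<n) + v * entry n k (s≤s⁻¹ k<n)

{-# OPTIONS --safe #-}
module Submission where

-- A root x of x² = α x + β turns the row recurrence into multiplication: if the
-- left diagonal is xⁿ, then a n k = xⁿ pᵏ with p = u + v / x, where 1 / x is minus the
-- other root over β.  For D ≠ 0 the diagonal is a combination of the powers of x₁ and x₂,
-- so a n k = B₁ p₁ᵏ + B₂ p₂ᵏ with B₁, B₂ determined by a n 0 and a n 1.  For D = 0 the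
-- diagonal is (a₀ + n r) xⁿ with x = α / 2, and p = 𝒜 / α: if 𝒜 ≠ 0, then
-- a n k = (a₀ + n r + k t) xⁿ pᵏ for a constant t, and if 𝒜 = 0, then the first column
-- is a multiple of xⁿ, which the row recurrence annihilates.

open import Defs
open import Data.Nat.Base as ℕ using (_∸_; z≤n)
open import Data.Product.Base using (_×_)

open import Algebra.Apartness.Bundles using (HeytingField)
open import Algebra.Bundles using (CommutativeRing)
import Algebra.Apartness.Properties.HeytingCommutativeRing as HeytingProperties
import Algebra.Properties.Ring as RingProperties
import Algebra.Properties.Semiring.Mult.TCOptimised as Multiplication
import Algebra.Solver.Ring as RingSolver
open import Algebra.Solver.Ring.AlmostCommutativeRing
  using (fromCommutativeRing; _-Raw-AlmostCommutative⟶_)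
open import Data.Integer.Base as ℤ using (ℤ; +_; -[1+_]; _⊖_; _◃_)
import Data.Integer.Properties as ℤ
open import Data.Maybe.Base as Maybe using (Maybe)
open import Data.Nat.Base using (ℕ; zero; suc; s≤s; s≤s⁻¹)
import Data.Nat.Properties as ℕ
open import Data.Product.Base using (_,_; proj₁)
import Data.Sign.Base as Sign
open import Level using (Level)
open import Relation.Binary.Consequences using (dec⇒weaklyDec)
import Relation.Binary.PropositionalEquality.Core as ≡
import Relation.Binary.Reasoning.Setoid as SetoidReasoning

private variable
  c ℓ ℓ₁ ℓ₂ : Level

-- Ring solving with integer coefficients over a commutative ring

module IntegerCoefficients (R : CommutativeRing c ℓ) where

  open CommutativeRing R
  open RingProperties ring
  open Multiplication semiring using (1+×; ×-homo-+; ×1-homo-*) renaming (_×_ to _×ⁿ_)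
  open SetoidReasoning setoid

  -- The optimised multiple makes `1 ×ⁿ 1#` compute to `1#`, so that `1-homo` below is reflexivity.
  fromℤ : ℤ → Carrier
  fromℤ (+ n)    = n ×ⁿ 1#
  fromℤ -[1+ n ] = - (suc n ×ⁿ 1#)

  fromℤ-cong : ∀ {i j} → i ≡.≡ j → fromℤ i ≈ fromℤ j
  fromℤ-cong ≡.refl = refl

  fromℤ-homo-neg : ∀ i → fromℤ (ℤ.- i) ≈ - fromℤ i
  fromℤ-homo-neg (+ zero)  = sym -0#≈0#
  fromℤ-homo-neg (+ suc n) = refl
  fromℤ-homo-neg -[1+ n ]  = sym (-‿involutive _)

  -- Integer addition with mixed signs computes through `⊖`, so this is the hard case of additivity.
  -- Each inductive step cancels one `1#` against its negative.
  fromℤ-homo-⊖ : ∀ m n → fromℤ (m ⊖ n) ≈ m ×ⁿ 1# - n ×ⁿ 1#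
  fromℤ-homo-⊖ zero    zero    = sym (-‿inverseʳ _)
  fromℤ-homo-⊖ zero    (suc n) = sym (+-identityˡ _)
  fromℤ-homo-⊖ (suc m) zero    = sym (trans (+-congˡ -0#≈0#) (+-identityʳ _))
  fromℤ-homo-⊖ (suc m) (suc n) = begin
    fromℤ (suc m ⊖ suc n)               ≈⟨ fromℤ-cong (ℤ.[1+m]⊖[1+n]≡m⊖n m n) ⟩
    fromℤ (m ⊖ n)                       ≈⟨ fromℤ-homo-⊖ m n ⟩
    M - N                               ≈⟨ +-congʳ (xyx⁻¹≈y 1# M) ⟨
    1# + M - 1# - N                     ≈⟨ +-assoc _ _ _ ⟩
    1# + M + (- 1# - N)                 ≈⟨ +-congˡ (-‿+-comm _ _) ⟩
    1# + M - (1# + N)                   ≈⟨ +-cong (1+× m 1#) (-‿cong (1+× n 1#)) ⟨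
    suc m ×ⁿ 1# - suc n ×ⁿ 1#           ∎
    where
    M = m ×ⁿ 1#
    N = n ×ⁿ 1#

  fromℤ-homo-+ : ∀ i j → fromℤ (i ℤ.+ j) ≈ fromℤ i + fromℤ j
  fromℤ-homo-+ (+ m)    (+ n)    = ×-homo-+ 1# m n
  fromℤ-homo-+ (+ m)    -[1+ n ] = fromℤ-homo-⊖ m (suc n)
  fromℤ-homo-+ -[1+ m ] (+ n)    = trans (fromℤ-homo-⊖ n (suc m)) (+-comm _ _)
  fromℤ-homo-+ -[1+ m ] -[1+ n ] = begin
    - (suc (suc (m ℕ.+ n)) ×ⁿ 1#)          ≡⟨ ≡.cong (λ k → - (suc k ×ⁿ 1#)) (ℕ.+-suc m n) ⟨
    - ((suc m ℕ.+ suc n) ×ⁿ 1#)            ≈⟨ -‿cong (×-homo-+ 1# (suc m) (suc n)) ⟩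
    - (suc m ×ⁿ 1# + suc n ×ⁿ 1#)          ≈⟨ -‿+-comm _ _ ⟨
    - (suc m ×ⁿ 1#) - suc n ×ⁿ 1#          ∎

  -- Integer multiplication computes to a sign attached to a product of absolute values; this lemma
  -- and the next treat the two signs.
  fromℤ-pos : ∀ m n → fromℤ (Sign.+ ◃ m ℕ.* n) ≈ (m ×ⁿ 1#) * (n ×ⁿ 1#)
  fromℤ-pos m n = trans (fromℤ-cong (ℤ.+◃n≡+n (m ℕ.* n))) (×1-homo-* m n)

  fromℤ-neg : ∀ m n → fromℤ (Sign.- ◃ m ℕ.* n) ≈ - ((m ×ⁿ 1#) * (n ×ⁿ 1#))
  fromℤ-neg m n = begin
    fromℤ (Sign.- ◃ m ℕ.* n)       ≈⟨ fromℤ-cong (ℤ.-◃n≡-n (m ℕ.* n)) ⟩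
    fromℤ (ℤ.- (+ (m ℕ.* n)))      ≈⟨ fromℤ-homo-neg (+ (m ℕ.* n)) ⟩
    - ((m ℕ.* n) ×ⁿ 1#)            ≈⟨ -‿cong (×1-homo-* m n) ⟩
    - ((m ×ⁿ 1#) * (n ×ⁿ 1#))      ∎

  fromℤ-homo-* : ∀ i j → fromℤ (i ℤ.* j) ≈ fromℤ i * fromℤ j
  fromℤ-homo-* (+ m)    (+ n)    = fromℤ-pos m n
  fromℤ-homo-* (+ m)    -[1+ n ] = trans (fromℤ-neg m (suc n)) (-‿distribʳ-* _ _)
  fromℤ-homo-* -[1+ m ] (+ n)    = trans (fromℤ-neg (suc m) n) (-‿distribˡ-* _ _)
  fromℤ-homo-* -[1+ m ] -[1+ n ] = begin
    fromℤ (Sign.+ ◃ suc m ℕ.* suc n)  ≈⟨ fromℤ-pos (suc m) (suc n) ⟩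
    M * N                             ≈⟨ -‿involutive _ ⟨
    - (- (M * N))                     ≈⟨ -‿cong (-‿distribˡ-* M N) ⟩
    - (- M * N)                       ≈⟨ -‿distribʳ-* (- M) N ⟩
    - M * - N                         ∎
    where
    M = suc m ×ⁿ 1#
    N = suc n ×ⁿ 1#

  fromℤ-morphism : ℤ.+-*-rawRing -Raw-AlmostCommutative⟶ fromCommutativeRing R
  fromℤ-morphism = record
    { ⟦_⟧    = fromℤ
    ; +-homo = fromℤ-homo-+
    ; *-homo = fromℤ-homo-*
    ; -‿homo = fromℤ-homo-neg
    ; 0-homo = refl
    ; 1-homo = refl
    }

  -- Unequal integers can have equal images, as in positive characteristic, so only positive answers
  -- are given.
  fromℤ-dec : ∀ i j → Maybe (fromℤ i ≈ fromℤ j)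
  fromℤ-dec i j = Maybe.map fromℤ-cong (dec⇒weaklyDec ℤ._≟_ i j)

  open RingSolver ℤ.+-*-rawRing (fromCommutativeRing R) fromℤ-morphism fromℤ-dec public
    using (Polynomial; solve; _:=_; _:+_; _:*_; _:-_; :-_; con)

  -- Shaped so that :2 and :4 evaluate to fromℕ 2 and fromℕ 4 definitionally.
  :0 :1 :2 :4 : ∀ {n} → Polynomial n
  :0 = con (+ 0)
  :1 = con (+ 1)
  :2 = :1 :+ (:1 :+ :0)
  :4 = :1 :+ (:1 :+ :2)

-- Division in a Heyting field

module FieldTheory (F : HeytingField c ℓ₁ ℓ₂) where

  open HeytingField F
  open FieldArithmetic F
  open HeytingProperties heytingCommutativeRing using (#-congʳ)
  open IntegerCoefficients commutativeRing
  open RingProperties (CommutativeRing.ring commutativeRing) using (x≈y⇒x∙y⁻¹≈ε)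
  open SetoidReasoning setoid

  ÷-*-cancel : ∀ x y (y#0 : y # 0#) → (x ÷ y [ y#0 ]) * y ≈ x
  ÷-*-cancel x y y#0 =
    trans (*-assoc x _ y) (trans (*-congˡ (inv-inverseˡ y y#0)) (*-identityʳ x))

  *-÷-cancel : ∀ x y (y#0 : y # 0#) → (x * y) ÷ y [ y#0 ] ≈ x
  *-÷-cancel x y y#0 = begin
    x * y * inv y y#0     ≈⟨ solve 3 (λ x y i → x :* y :* i := x :* (i :* y)) refl x y _ ⟩
    x * (inv y y#0 * y)   ≈⟨ *-congˡ (inv-inverseˡ y y#0) ⟩
    x * 1#                ≈⟨ *-identityʳ x ⟩
    x                     ∎

  ÷-unique : ∀ {x y z} (y#0 : y # 0#) → z * y ≈ x → z ≈ x ÷ y [ y#0 ]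
  ÷-unique {y = y} {z} y#0 zy≈x = trans (sym (*-÷-cancel z y y#0)) (*-congʳ zy≈x)

  -- Clears denominators: an equation between quotients is multiplied through until it becomes a
  -- polynomial identity within reach of the solver.
  *-cancelʳ-#0 : ∀ {x y z} → z # 0# → x * z ≈ y * z → x ≈ y
  *-cancelʳ-#0 {x} {y} {z} z#0 xz≈yz = trans (÷-unique z#0 xz≈yz) (*-÷-cancel y z z#0)

  -- Lets a hypothesis l ≈ r enter a solver identity, as the term k * (l - r).
  vanish : ∀ {x} k {l r} → l ≈ r → x + k * (l - r) ≈ x
  vanish {x} k {l} {r} l≈r = begin
    x + k * (l - r)   ≈⟨ +-congˡ (*-congˡ (x≈y⇒x∙y⁻¹≈ε l≈r)) ⟩
    x + k * 0#        ≈⟨ solve 2 (λ x k → x :+ k :* :0 := x) refl x k ⟩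
    x                 ∎

  -- Triangles over any Heyting field, known only through their recurrences, to serve ℝ and ℂ alike

  module TriangleOver
    (α β u v : Carrier)
    (a : ∀ n k → .(k ℕ.≤ n) → Carrier)
    (diagonal-step : ∀ n →
      a (suc (suc n)) 0 z≤n ≈ α * a (suc n) 0 z≤n + β * a n 0 z≤n)
    (entry-step : ∀ n k .(k<n : suc k ℕ.≤ suc n) →
      a (suc n) (suc k) k<n ≈
        u * a (suc n) k (ℕ.<⇒≤ k<n) + v * a n k (s≤s⁻¹ k<n))
    where

    a₀ a₁ : Carrier
    a₀ = a 0 0 z≤n
    a₁ = a 1 0 z≤n

    -- A second-order recurrence is fixed by its first two values, so a closed form of the left
    -- diagonal need only be checked at 0, at 1 and against the recurrence.
    diagonal-unique : (f : ℕ → Carrier) →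
      (∀ n → f (suc (suc n)) ≈ α * f (suc n) + β * f n) →
      a₀ ≈ f 0 → a₁ ≈ f 1 → ∀ n → a n 0 z≤n ≈ f n
    diagonal-unique f step a₀≈ a₁≈ zero          = a₀≈
    diagonal-unique f step a₀≈ a₁≈ (suc zero)    = a₁≈
    diagonal-unique f step a₀≈ a₁≈ (suc (suc n)) = begin
      a (suc (suc n)) 0 z≤n                   ≈⟨ diagonal-step n ⟩
      α * a (suc n) 0 z≤n + β * a n 0 z≤n     ≈⟨ +-cong
        (*-congˡ (diagonal-unique f step a₀≈ a₁≈ (suc n)))
        (*-congˡ (diagonal-unique f step a₀≈ a₁≈ n)) ⟩
      α * f (suc n) + β * f n                 ≈⟨ step n ⟨
      f (suc (suc n))                         ∎

    -- Two distinct roots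

    module DistinctRoots
      -- The quotients enter as variables with their defining equations cleared of denominators,
      -- which keeps every identity below polynomial.
      {D x₁ x₂ p₁ p₂ A₁ A₂ : Carrier}
      (2#0 : 2# # 0#) (β#0 : β # 0#)
      (2D#0 : 2# * D # 0#) (2vD#0 : 2# * v * D # 0#)
      (D²≈α²+4β : D * D ≈ α * α + 4# * β)
      (x₁*2≈α+D : x₁ * 2# ≈ α + D)
      (x₂*2≈α-D : x₂ * 2# ≈ α - D)
      (p₁*β≈ : p₁ * β ≈ β * u - v * x₂)
      (p₂*β≈ : p₂ * β ≈ β * u - v * x₁)
      (A₁*2D≈ : A₁ * (2# * D) ≈ (D - α) * a₀ + 2# * a₁)
      (A₂*2D≈ : A₂ * (2# * D) ≈ (D + α) * a₀ - 2# * a₁)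
      where

      x₁+x₂≈α : x₁ + x₂ ≈ α
      x₁+x₂≈α = *-cancelʳ-#0 2#0 (begin
        (x₁ + x₂) * 2#            ≈⟨ distribʳ _ _ _ ⟩
        x₁ * 2# + x₂ * 2#         ≈⟨ +-cong x₁*2≈α+D x₂*2≈α-D ⟩
        α + D + (α - D)           ≈⟨ solve 2 (λ α D → α :+ D :+ (α :- D) := α :* :2) refl α D ⟩
        α * 2#                    ∎)

      x₁-x₂≈D : x₁ - x₂ ≈ D
      x₁-x₂≈D = *-cancelʳ-#0 2#0 (begin
        (x₁ - x₂) * 2#            ≈⟨ solve 2 (λ x y →
                                       (x :- y) :* :2 := x :* :2 :- y :* :2) refl x₁ x₂ ⟩
        x₁ * 2# - x₂ * 2#         ≈⟨ +-cong x₁*2≈α+D (-‿cong x₂*2≈α-D) ⟩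
        α + D - (α - D)           ≈⟨ solve 2 (λ α D → α :+ D :- (α :- D) := D :* :2) refl α D ⟩
        D * 2#                    ∎)

      -- Four times the product is α² - D², which is -4β.
      x₁*x₂≈-β : x₁ * x₂ ≈ - β
      x₁*x₂≈-β = *-cancelʳ-#0 2#0 (*-cancelʳ-#0 2#0 (begin
        x₁ * x₂ * 2# * 2#
          ≈⟨ solve 2 (λ x y → x :* y :* :2 :* :2 := (x :* :2) :* (y :* :2)) refl x₁ x₂ ⟩
        (x₁ * 2#) * (x₂ * 2#)
          ≈⟨ *-cong x₁*2≈α+D x₂*2≈α-D ⟩
        (α + D) * (α - D)
          ≈⟨ solve 3 (λ α β D → (α :+ D) :* (α :- D) :=
               :- β :* :2 :* :2 :+ :- :1 :* (D :* D :- (α :* α :+ :4 :* β))) refl α β D ⟩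
        - β * 2# * 2# + - 1# * (D * D - (α * α + 4# * β))
          ≈⟨ vanish (- 1#) D²≈α²+4β ⟩
        - β * 2# * 2# ∎))

      -- The characteristic equation is a combination of the Vieta relations: x₁² - α x₁ - β = x₁
      -- (x₁ + x₂ - α) - (x₁ x₂ + β).
      x₁²≈αx₁+β : x₁ * x₁ ≈ α * x₁ + β
      x₁²≈αx₁+β = begin
        x₁ * x₁
          ≈⟨ solve 4 (λ α β x y → x :* x :=
               α :* x :+ β :+ x :* (x :+ y :- α) :+ :- :1 :* (x :* y :- :- β)) refl α β x₁ x₂ ⟩
        α * x₁ + β + x₁ * (x₁ + x₂ - α) + - 1# * (x₁ * x₂ - - β)
          ≈⟨ vanish _ x₁*x₂≈-β ⟩
        α * x₁ + β + x₁ * (x₁ + x₂ - α)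
          ≈⟨ vanish _ x₁+x₂≈α ⟩
        α * x₁ + β ∎

      x₂²≈αx₂+β : x₂ * x₂ ≈ α * x₂ + β
      x₂²≈αx₂+β = begin
        x₂ * x₂
          ≈⟨ solve 4 (λ α β x y → y :* y :=
               α :* y :+ β :+ y :* (x :+ y :- α) :+ :- :1 :* (x :* y :- :- β)) refl α β x₁ x₂ ⟩
        α * x₂ + β + x₂ * (x₁ + x₂ - α) + - 1# * (x₁ * x₂ - - β)
          ≈⟨ vanish _ x₁*x₂≈-β ⟩
        α * x₂ + β + x₂ * (x₁ + x₂ - α)
          ≈⟨ vanish _ x₁+x₂≈α ⟩
        α * x₂ + β ∎

      -- From x₁ x₂ = -β, the inverse of x₁ is -x₂ / β; this is why `p₁` is built from the opposite
      -- root `x₂`.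
      x₁*p₁≈ux₁+v : x₁ * p₁ ≈ u * x₁ + v
      x₁*p₁≈ux₁+v = *-cancelʳ-#0 β#0 (begin
        x₁ * p₁ * β
          ≈⟨ solve 6 (λ β u v x y p → x :* p :* β :=
               (u :* x :+ v) :* β :+ x :* (p :* β :- (β :* u :- v :* y))
                 :+ :- v :* (x :* y :- :- β)) refl β u v x₁ x₂ p₁ ⟩
        (u * x₁ + v) * β + x₁ * (p₁ * β - (β * u - v * x₂)) + - v * (x₁ * x₂ - - β)
          ≈⟨ vanish _ x₁*x₂≈-β ⟩
        (u * x₁ + v) * β + x₁ * (p₁ * β - (β * u - v * x₂))
          ≈⟨ vanish _ p₁*β≈ ⟩
        (u * x₁ + v) * β ∎)

      x₂*p₂≈ux₂+v : x₂ * p₂ ≈ u * x₂ + v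
      x₂*p₂≈ux₂+v = *-cancelʳ-#0 β#0 (begin
        x₂ * p₂ * β
          ≈⟨ solve 6 (λ β u v x y p → y :* p :* β :=
               (u :* y :+ v) :* β :+ y :* (p :* β :- (β :* u :- v :* x))
                 :+ :- v :* (x :* y :- :- β)) refl β u v x₁ x₂ p₂ ⟩
        (u * x₂ + v) * β + x₂ * (p₂ * β - (β * u - v * x₁)) + - v * (x₁ * x₂ - - β)
          ≈⟨ vanish _ x₁*x₂≈-β ⟩
        (u * x₂ + v) * β + x₂ * (p₂ * β - (β * u - v * x₁))
          ≈⟨ vanish _ p₂*β≈ ⟩
        (u * x₂ + v) * β ∎)

      diagonal-closed : ∀ n → a n 0 z≤n ≈ A₁ * x₁ ^ n + A₂ * x₂ ^ n
      diagonal-closed = diagonal-unique (λ n → A₁ * x₁ ^ n + A₂ * x₂ ^ n) step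
        (*-cancelʳ-#0 2D#0 (begin
          a₀ * (2# * D)
            ≈⟨ solve 4 (λ α D y z → y :* (:2 :* D) :=
                 ((D :- α) :* y :+ :2 :* z) :+ ((D :+ α) :* y :- :2 :* z)) refl α D a₀ a₁ ⟩
          ((D - α) * a₀ + 2# * a₁) + ((D + α) * a₀ - 2# * a₁)
            ≈⟨ +-cong A₁*2D≈ A₂*2D≈ ⟨
          A₁ * (2# * D) + A₂ * (2# * D)
            ≈⟨ solve 3 (λ A B D → A :* (:2 :* D) :+ B :* (:2 :* D) :=
                 (A :* :1 :+ B :* :1) :* (:2 :* D)) refl A₁ A₂ D ⟩
          (A₁ * 1# + A₂ * 1#) * (2# * D) ∎))
        (*-cancelʳ-#0 2D#0 (begin
          a₁ * (2# * D)
            -- The numerators weighted by the roots give a₀ D (x₁ + x₂) - (α a₀ - 2 a₁) (x₁ - x₂),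
            -- which the sum α and the difference D of the roots turn into 2 D a₁.
            ≈⟨ solve 6 (λ α D y z x w → z :* (:2 :* D) :=
                 ((D :- α) :* y :+ :2 :* z) :* x :+ ((D :+ α) :* y :- :2 :* z) :* w
                   :+ :- (y :* D) :* (x :+ w :- α) :+ (α :* y :- :2 :* z) :* (x :- w :- D))
                 refl α D a₀ a₁ x₁ x₂ ⟩
          ((D - α) * a₀ + 2# * a₁) * x₁ + ((D + α) * a₀ - 2# * a₁) * x₂
            + - (a₀ * D) * (x₁ + x₂ - α) + (α * a₀ - 2# * a₁) * (x₁ - x₂ - D)
            ≈⟨ vanish _ x₁-x₂≈D ⟩
          ((D - α) * a₀ + 2# * a₁) * x₁ + ((D + α) * a₀ - 2# * a₁) * x₂
            + - (a₀ * D) * (x₁ + x₂ - α)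
            ≈⟨ vanish _ x₁+x₂≈α ⟩
          ((D - α) * a₀ + 2# * a₁) * x₁ + ((D + α) * a₀ - 2# * a₁) * x₂
            ≈⟨ +-cong (*-congʳ A₁*2D≈) (*-congʳ A₂*2D≈) ⟨
          A₁ * (2# * D) * x₁ + A₂ * (2# * D) * x₂
            ≈⟨ solve 5 (λ A B D x y → A :* (:2 :* D) :* x :+ B :* (:2 :* D) :* y :=
                 (A :* (x :* :1) :+ B :* (y :* :1)) :* (:2 :* D)) refl A₁ A₂ D x₁ x₂ ⟩
          (A₁ * (x₁ * 1#) + A₂ * (x₂ * 1#)) * (2# * D) ∎))
        where
        step : ∀ n → A₁ * x₁ ^ suc (suc n) + A₂ * x₂ ^ suc (suc n) ≈
          α * (A₁ * x₁ ^ suc n + A₂ * x₂ ^ suc n) + β * (A₁ * x₁ ^ n + A₂ * x₂ ^ n)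
        step n = begin
          A₁ * (x₁ * (x₁ * X₁)) + A₂ * (x₂ * (x₂ * X₂))
            ≈⟨ solve 6 (λ A B x y X Y →
                 A :* (x :* (x :* X)) :+ B :* (y :* (y :* Y)) :=
                 A :* X :* (x :* x) :+ B :* Y :* (y :* y)) refl A₁ A₂ x₁ x₂ X₁ X₂ ⟩
          A₁ * X₁ * (x₁ * x₁) + A₂ * X₂ * (x₂ * x₂)
            ≈⟨ +-cong (*-congˡ x₁²≈αx₁+β) (*-congˡ x₂²≈αx₂+β) ⟩
          A₁ * X₁ * (α * x₁ + β) + A₂ * X₂ * (α * x₂ + β)
            ≈⟨ solve 8 (λ α β A B x y X Y →
                 A :* X :* (α :* x :+ β) :+ B :* Y :* (α :* y :+ β) :=
                 α :* (A :* (x :* X) :+ B :* (y :* Y)) :+ β :* (A :* X :+ B :* Y))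
                 refl α β A₁ A₂ x₁ x₂ X₁ X₂ ⟩
          α * (A₁ * (x₁ * X₁) + A₂ * (x₂ * X₂)) + β * (A₁ * X₁ + A₂ * X₂) ∎
          where
          X₁ = x₁ ^ n
          X₂ = x₂ ^ n

      -- Rows n and n - 1 of the diagonal enter, and 1 ≤ n makes the truncated `n ∸ 1` a true
      -- predecessor.
      first-column-closed : ∀ n (1≤n : 1 ℕ.≤ n) → a n 1 1≤n ≈
        A₁ * x₁ ^ (n ∸ 1) * (u * x₁ + v) + A₂ * x₂ ^ (n ∸ 1) * (u * x₂ + v)
      first-column-closed (suc n) 1≤n = begin
        a (suc n) 1 1≤n
          ≈⟨ entry-step n 0 1≤n ⟩
        u * a (suc n) 0 z≤n + v * a n 0 z≤n
          ≈⟨ +-cong (*-congˡ (diagonal-closed (suc n))) (*-congˡ (diagonal-closed n)) ⟩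
        u * (A₁ * (x₁ * X₁) + A₂ * (x₂ * X₂)) + v * (A₁ * X₁ + A₂ * X₂)
          ≈⟨ solve 8 (λ u v A B x y X Y →
               u :* (A :* (x :* X) :+ B :* (y :* Y)) :+ v :* (A :* X :+ B :* Y) :=
               A :* X :* (u :* x :+ v) :+ B :* Y :* (u :* y :+ v))
               refl u v A₁ A₂ x₁ x₂ X₁ X₂ ⟩
        A₁ * X₁ * (u * x₁ + v) + A₂ * X₂ * (u * x₂ + v) ∎
        where
        X₁ = x₁ ^ n
        X₂ = x₂ ^ n

      -- On xⁿ pᵏ the row recurrence gives xⁿ pᵏ (u x + v), and u x + v = x p raises both exponents
      -- by one. Linearity handles the sum.
      entry-power-sum : ∀ n k .(k≤n : k ℕ.≤ n) →
        a n k k≤n ≈ A₁ * x₁ ^ n * p₁ ^ k + A₂ * x₂ ^ n * p₂ ^ k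
      entry-power-sum n zero k≤n =
        trans (diagonal-closed n) (sym (+-cong (*-identityʳ _) (*-identityʳ _)))
      entry-power-sum zero (suc k) ()
      entry-power-sum (suc n) (suc k) k<n = begin
        a (suc n) (suc k) k<n
          ≈⟨ entry-step n k k<n ⟩
        u * a (suc n) k _ + v * a n k _
          ≈⟨ +-cong (*-congˡ (entry-power-sum (suc n) k (ℕ.<⇒≤ k<n)))
                    (*-congˡ (entry-power-sum n k (s≤s⁻¹ k<n))) ⟩
        u * (A₁ * (x₁ * X₁) * P₁ + A₂ * (x₂ * X₂) * P₂) + v * (A₁ * X₁ * P₁ + A₂ * X₂ * P₂)
          ≈⟨ solve 10 (λ u v A B x y X Y P Q →
               u :* (A :* (x :* X) :* P :+ B :* (y :* Y) :* Q)
                 :+ v :* (A :* X :* P :+ B :* Y :* Q) :=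
               A :* X :* P :* (u :* x :+ v) :+ B :* Y :* Q :* (u :* y :+ v))
               refl u v A₁ A₂ x₁ x₂ X₁ X₂ P₁ P₂ ⟩
        A₁ * X₁ * P₁ * (u * x₁ + v) + A₂ * X₂ * P₂ * (u * x₂ + v)
          ≈⟨ +-cong (*-congˡ x₁*p₁≈ux₁+v) (*-congˡ x₂*p₂≈ux₂+v) ⟨
        A₁ * X₁ * P₁ * (x₁ * p₁) + A₂ * X₂ * P₂ * (x₂ * p₂)
          ≈⟨ +-cong (regroup A₁ X₁ P₁ x₁ p₁) (regroup A₂ X₂ P₂ x₂ p₂) ⟩
        A₁ * (x₁ * X₁) * (p₁ * P₁) + A₂ * (x₂ * X₂) * (p₂ * P₂) ∎
        where
        X₁ = x₁ ^ n
        X₂ = x₂ ^ n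
        P₁ = p₁ ^ k
        P₂ = p₂ ^ k
        regroup : ∀ A X P x p → A * X * P * (x * p) ≈ A * (x * X) * (p * P)
        regroup = solve 5 (λ A X P x p →
          A :* X :* P :* (x :* p) := A :* (x :* X) :* (p :* P)) refl

      entry-first-column : ∀ n (1≤n : 1 ℕ.≤ n) →
        a n 1 1≤n ≈ A₁ * x₁ ^ n * p₁ + A₂ * x₂ ^ n * p₂
      entry-first-column n 1≤n = trans (entry-power-sum n 1 1≤n)
        (+-cong (*-congˡ (*-identityʳ p₁)) (*-congˡ (*-identityʳ p₂)))

      -- With B = A xⁿ for each root, B₁ + B₂ is the diagonal entry and B₁ p₁ + B₂ p₂ the next one.
      -- This linear system has determinant ±(p₁ - p₂) = ±v D / β, and its solution is the pair
      -- `C₁`, `C₂`.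
      entry-closed : ∀ {C₁ C₂} n k (1≤n : 1 ℕ.≤ n) (k≤n : k ℕ.≤ n) →
        C₁ * (2# * v * D) ≈
          (v * D + α * v - 2# * β * u) * a n 0 z≤n + 2# * β * a n 1 1≤n →
        C₂ * (2# * v * D) ≈
          (v * D - α * v + 2# * β * u) * a n 0 z≤n - 2# * β * a n 1 1≤n →
        a n k k≤n ≈ C₁ * p₁ ^ k + C₂ * p₂ ^ k
      entry-closed n k 1≤n k≤n C₁*2vD≈ C₂*2vD≈ = trans (entry-power-sum n k k≤n)
        (+-cong (*-congʳ (*-cancelʳ-#0 2vD#0 (trans first (sym C₁*2vD≈))))
                (*-congʳ (*-cancelʳ-#0 2vD#0 (trans second (sym C₂*2vD≈)))))
        where
        B₁ = A₁ * x₁ ^ n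
        B₂ = A₂ * x₂ ^ n
        d = a n 0 z≤n
        e = a n 1 1≤n
        first : B₁ * (2# * v * D) ≈ (v * D + α * v - 2# * β * u) * d + 2# * β * e
        first = sym (begin
          (v * D + α * v - 2# * β * u) * d + 2# * β * e
            ≈⟨ +-cong (*-congˡ (diagonal-closed n)) (*-congˡ (entry-first-column n 1≤n)) ⟩
          (v * D + α * v - 2# * β * u) * (B₁ + B₂) + 2# * β * (B₁ * p₁ + B₂ * p₂)
            ≈⟨ solve 9 (λ α β u v D p q B C →
                 (v :* D :+ α :* v :- :2 :* β :* u) :* (B :+ C) :+ :2 :* β :* (B :* p :+ C :* q) :=
                 (v :* D :+ α :* v :- :2 :* β :* u) :* (B :+ C)
                   :+ :2 :* B :* (p :* β) :+ :2 :* C :* (q :* β))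
                 refl α β u v D p₁ p₂ B₁ B₂ ⟩
          (v * D + α * v - 2# * β * u) * (B₁ + B₂) + 2# * B₁ * (p₁ * β) + 2# * B₂ * (p₂ * β)
            ≈⟨ +-cong (+-congˡ (*-congˡ p₁*β≈)) (*-congˡ p₂*β≈) ⟩
          (v * D + α * v - 2# * β * u) * (B₁ + B₂)
            + 2# * B₁ * (β * u - v * x₂) + 2# * B₂ * (β * u - v * x₁)
            -- With 2 x₂ = α - D the coefficient of `B₁` becomes 2 v D; with 2 x₁ = α + D that of
            -- `B₂` vanishes.
            ≈⟨ solve 9 (λ α β u v D x y B C →
                 (v :* D :+ α :* v :- :2 :* β :* u) :* (B :+ C)
                   :+ :2 :* B :* (β :* u :- v :* y) :+ :2 :* C :* (β :* u :- v :* x) :=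
                 B :* (:2 :* v :* D)
                   :+ :- (B :* v) :* (y :* :2 :- (α :- D)) :+ :- (C :* v) :* (x :* :2 :- (α :+ D)))
                 refl α β u v D x₁ x₂ B₁ B₂ ⟩
          B₁ * (2# * v * D) + - (B₁ * v) * (x₂ * 2# - (α - D)) + - (B₂ * v) * (x₁ * 2# - (α + D))
            ≈⟨ vanish _ x₁*2≈α+D ⟩
          B₁ * (2# * v * D) + - (B₁ * v) * (x₂ * 2# - (α - D))
            ≈⟨ vanish _ x₂*2≈α-D ⟩
          B₁ * (2# * v * D) ∎)
        -- The two numerators add up to 2 v D `d`, and `B₁` + `B₂` = `d`, so this is the complement
        -- of `first`.
        second : B₂ * (2# * v * D) ≈ (v * D - α * v + 2# * β * u) * d - 2# * β * e
        second = begin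
          B₂ * (2# * v * D)
            ≈⟨ solve 4 (λ v D B C → C :* (:2 :* v :* D) :=
                 :2 :* v :* D :* (B :+ C) :- B :* (:2 :* v :* D)) refl v D B₁ B₂ ⟩
          2# * v * D * (B₁ + B₂) - B₁ * (2# * v * D)
            ≈⟨ +-cong (*-congˡ (sym (diagonal-closed n))) (-‿cong first) ⟩
          2# * v * D * d - ((v * D + α * v - 2# * β * u) * d + 2# * β * e)
            ≈⟨ solve 7 (λ α β u v D d e →
                 :2 :* v :* D :* d :- ((v :* D :+ α :* v :- :2 :* β :* u) :* d :+ :2 :* β :* e) :=
                 (v :* D :- α :* v :+ :2 :* β :* u) :* d :- :2 :* β :* e) refl α β u v D d e ⟩
          (v * D - α * v + 2# * β * u) * d - 2# * β * e ∎

    -- A double root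

    module DoubleRoot
      (α²+4β≈0 : α * α + 4# * β ≈ 0#) (2#0 : 2# # 0#) (α#0 : α # 0#)
      where

      x r 𝒜 : Carrier
      x = α ÷ 2# [ 2#0 ]
      r = (2# * a₁ - α * a₀) ÷ α [ α#0 ]
      𝒜 = u * α + 2# * v

      x*2≈α : x * 2# ≈ α
      x*2≈α = ÷-*-cancel α 2# 2#0

      r*α≈ : r * α ≈ 2# * a₁ - α * a₀
      r*α≈ = ÷-*-cancel _ α α#0

      -- A zero discriminant means β = -α² / 4, so `x` = α / 2 is the double root.
      β≈-x² : β ≈ - (x * x)
      β≈-x² = *-cancelʳ-#0 2#0 (*-cancelʳ-#0 2#0 (begin
        β * 2# * 2#
          ≈⟨ solve 3 (λ α β x → β :* :2 :* :2 :=
               :- (x :* x) :* :2 :* :2 :+ :1 :* (α :* α :+ :4 :* β :- :0)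
                 :+ (x :* :2 :+ α) :* (x :* :2 :- α)) refl α β x ⟩
        - (x * x) * 2# * 2# + 1# * (α * α + 4# * β - 0#) + (x * 2# + α) * (x * 2# - α)
          ≈⟨ vanish _ x*2≈α ⟩
        - (x * x) * 2# * 2# + 1# * (α * α + 4# * β - 0#)
          ≈⟨ vanish _ α²+4β≈0 ⟩
        - (x * x) * 2# * 2# ∎))

      -- The row recurrence multiplies xⁿ by u x + v, so `𝒜` decides whether it annihilates the
      -- powers of `x`.
      ux+v*2≈𝒜 : (u * x + v) * 2# ≈ 𝒜
      ux+v*2≈𝒜 = begin
        (u * x + v) * 2#
          ≈⟨ solve 3 (λ u v x → (u :* x :+ v) :* :2 := u :* (x :* :2) :+ :2 :* v) refl u v x ⟩
        u * (x * 2#) + 2# * v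
          ≈⟨ +-congʳ (*-congˡ x*2≈α) ⟩
        u * α + 2# * v ∎

      -- At a double root both xⁿ and n xⁿ solve the recurrence. The increment `r` makes a₀ + r = 2
      -- a₁ / α, hence (a₀ + r) x = a₁.
      diagonal-closed : ∀ n → a n 0 z≤n ≈ (a₀ + fromℕ n * r) * x ^ n
      diagonal-closed = diagonal-unique (λ n → (a₀ + fromℕ n * r) * x ^ n) step
        (solve 2 (λ y r → y := (y :+ :0 :* r) :* :1) refl a₀ r)
        (*-cancelʳ-#0 2#0 (begin
          a₁ * 2#
            ≈⟨ solve 5 (λ α y z r x → z :* :2 :=
                 (y :+ (:1 :+ :0) :* r) :* (x :* :1) :* :2
                   :+ :- :1 :* (r :* α :- (:2 :* z :- α :* y)) :+ :- (y :+ r) :* (x :* :2 :- α))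
                 refl α a₀ a₁ r x ⟩
          (a₀ + (1# + 0#) * r) * (x * 1#) * 2#
            + - 1# * (r * α - (2# * a₁ - α * a₀)) + - (a₀ + r) * (x * 2# - α)
            ≈⟨ vanish _ x*2≈α ⟩
          (a₀ + (1# + 0#) * r) * (x * 1#) * 2# + - 1# * (r * α - (2# * a₁ - α * a₀))
            ≈⟨ vanish _ r*α≈ ⟩
          (a₀ + (1# + 0#) * r) * (x * 1#) * 2# ∎))
        where
        step : ∀ n → (a₀ + fromℕ (suc (suc n)) * r) * x ^ suc (suc n) ≈
          α * ((a₀ + fromℕ (suc n) * r) * x ^ suc n) + β * ((a₀ + fromℕ n * r) * x ^ n)
        step n = sym (begin
          α * ((a₀ + (1# + N) * r) * (x * X)) + β * ((a₀ + N * r) * X)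
            -- With α = 2 x and β = -x² the recurrence only says that the factor linear in n has
            -- second difference zero.
            ≈⟨ +-cong (*-congʳ (sym x*2≈α)) (*-congʳ β≈-x²) ⟩
          x * 2# * ((a₀ + (1# + N) * r) * (x * X)) + - (x * x) * ((a₀ + N * r) * X)
            ≈⟨ solve 5 (λ y N r x X →
                 x :* :2 :* ((y :+ (:1 :+ N) :* r) :* (x :* X))
                   :+ :- (x :* x) :* ((y :+ N :* r) :* X) :=
                 (y :+ (:1 :+ (:1 :+ N)) :* r) :* (x :* (x :* X))) refl a₀ N r x X ⟩
          (a₀ + (1# + (1# + N)) * r) * (x * (x * X)) ∎)
          where
          N = fromℕ n
          X = x ^ n

      first-column-closed : ∀ n (1≤n : 1 ℕ.≤ n) → a n 1 1≤n ≈
        u * a n 0 z≤n + v * (a₀ + fromℕ (n ∸ 1) * r) * x ^ (n ∸ 1)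
      first-column-closed (suc n) 1≤n =
        trans (entry-step n 0 1≤n)
          (+-congˡ (trans (*-congˡ (diagonal-closed n)) (sym (*-assoc _ _ _))))

      -- Double root with nonzero ratio

      module NonzeroRatio (𝒜#0 : 𝒜 # 0#) where

        q : Carrier
        q = 𝒜 ÷ α [ α#0 ]

        q*α≈𝒜 : q * α ≈ 𝒜
        q*α≈𝒜 = ÷-*-cancel 𝒜 α α#0

        -- Since α = 2 x and `𝒜` = 2 (u x + v), `q` is the common value u + v / x of the two ratios
        -- of the distinct case.
        x*q≈ux+v : x * q ≈ u * x + v
        x*q≈ux+v = *-cancelʳ-#0 2#0 (begin
          x * q * 2#         ≈⟨ solve 2 (λ x q → x :* q :* :2 := q :* (x :* :2)) refl x q ⟩
          q * (x * 2#)       ≈⟨ *-congˡ x*2≈α ⟩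
          q * α              ≈⟨ q*α≈𝒜 ⟩
          𝒜                  ≈⟨ ux+v*2≈𝒜 ⟨
          (u * x + v) * 2#   ∎)

        ux+v#0 : u * x + v # 0#
        ux+v#0 = *#0⇒ˡ#0 (#-congʳ (sym ux+v*2≈𝒜) 𝒜#0)

        -- The slope of a n k / (x ^ n * q ^ k) in k: the increment r in n costs
        -- v * r at each step of a row, and dividing by x * q rescales it.
        t : Carrier
        t = - (v * r) ÷ (u * x + v) [ ux+v#0 ]

        t*[ux+v]≈-vr : t * (u * x + v) ≈ - (v * r)
        t*[ux+v]≈-vr = ÷-*-cancel _ _ ux+v#0

        entry-slope : ∀ n k .(k≤n : k ℕ.≤ n) →
          a n k k≤n ≈ (a₀ + fromℕ n * r + fromℕ k * t) * x ^ n * q ^ k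
        entry-slope n zero k≤n = trans (diagonal-closed n)
          (solve 3 (λ y t X → y :* X := (y :+ :0 :* t) :* X :* :1)
             refl (a₀ + fromℕ n * r) t (x ^ n))
        entry-slope zero (suc k) ()
        entry-slope (suc n) (suc k) k<n = begin
          a (suc n) (suc k) k<n
            ≈⟨ entry-step n k k<n ⟩
          u * a (suc n) k _ + v * a n k _
            ≈⟨ +-cong (*-congˡ (entry-slope (suc n) k (ℕ.<⇒≤ k<n)))
                      (*-congˡ (entry-slope n k (s≤s⁻¹ k<n))) ⟩
          u * ((a₀ + (1# + N) * r + K * t) * (x * X) * Q) + v * ((a₀ + N * r + K * t) * X * Q)
            -- Row n has one `r` fewer than row n + 1, which leaves a defect -v r; it equals t (u x
            -- + v) and so becomes one more `t`.
            ≈⟨ solve 10 (λ u v y N r K t x X Q →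
                 u :* ((y :+ (:1 :+ N) :* r :+ K :* t) :* (x :* X) :* Q)
                   :+ v :* ((y :+ N :* r :+ K :* t) :* X :* Q) :=
                 (y :+ (:1 :+ N) :* r :+ (:1 :+ K) :* t) :* X :* Q :* (u :* x :+ v)
                   :+ :- (X :* Q) :* (t :* (u :* x :+ v) :- :- (v :* r)))
                 refl u v a₀ N r K t x X Q ⟩
          (a₀ + (1# + N) * r + (1# + K) * t) * X * Q * (u * x + v)
            + - (X * Q) * (t * (u * x + v) - - (v * r))
            ≈⟨ vanish _ t*[ux+v]≈-vr ⟩
          (a₀ + (1# + N) * r + (1# + K) * t) * X * Q * (u * x + v)
            ≈⟨ *-congˡ x*q≈ux+v ⟨
          (a₀ + (1# + N) * r + (1# + K) * t) * X * Q * (x * q)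
            ≈⟨ solve 5 (λ E X Q x q → E :* X :* Q :* (x :* q) := E :* (x :* X) :* (q :* Q))
                 refl _ X Q x q ⟩
          (a₀ + (1# + N) * r + (1# + K) * t) * (x * X) * (q * Q) ∎
          where
          N = fromℕ n
          K = fromℕ k
          X = x ^ n
          Q = q ^ k

        -- Eliminates the auxiliary `t`: the entry in column 1 is (E + t) xⁿ 𝒜 / α, where E xⁿ is
        -- the diagonal entry.
        slope-from-first-column : ∀ n (1≤n : 1 ℕ.≤ n) →
          t * x ^ n ≈ α * a n 1 1≤n ÷ 𝒜 [ 𝒜#0 ] - a n 0 z≤n
        slope-from-first-column n 1≤n = begin
          t * X
            ≈⟨ solve 3 (λ E t X → t :* X := (E :+ t) :* X :- E :* X) refl E t X ⟩
          (E + t) * X - E * X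
            ≈⟨ +-cong (÷-unique 𝒜#0 quotient) (-‿cong (sym (diagonal-closed n))) ⟩
          α * a n 1 1≤n ÷ 𝒜 [ 𝒜#0 ] - a n 0 z≤n ∎
          where
          E = a₀ + fromℕ n * r
          X = x ^ n
          quotient : (E + t) * X * 𝒜 ≈ α * a n 1 1≤n
          quotient = sym (begin
            α * a n 1 1≤n
              ≈⟨ *-congˡ (entry-slope n 1 1≤n) ⟩
            α * ((E + (1# + 0#) * t) * X * (q * 1#))
              ≈⟨ solve 5 (λ α E t X q → α :* ((E :+ (:1 :+ :0) :* t) :* X :* (q :* :1)) :=
                   (E :+ t) :* X :* (q :* α)) refl α E t X q ⟩
            (E + t) * X * (q * α)
              ≈⟨ *-congˡ q*α≈𝒜 ⟩
            (E + t) * X * 𝒜 ∎)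

        entry-closed : ∀ n k (1≤n : 1 ℕ.≤ n) (k≤n : k ℕ.≤ n) → a n k k≤n ≈
          (a n 0 z≤n + fromℕ k * (α * a n 1 1≤n ÷ 𝒜 [ 𝒜#0 ] - a n 0 z≤n)) * q ^ k
        entry-closed n k 1≤n k≤n = begin
          a n k k≤n
            ≈⟨ entry-slope n k k≤n ⟩
          (E + K * t) * X * q ^ k
            ≈⟨ *-congʳ (solve 4 (λ E K t X → (E :+ K :* t) :* X := E :* X :+ K :* (t :* X))
                 refl E K t X) ⟩
          (E * X + K * (t * X)) * q ^ k
            ≈⟨ *-congʳ (+-cong (sym (diagonal-closed n))
                 (*-congˡ (slope-from-first-column n 1≤n))) ⟩
          (a n 0 z≤n + K * (α * a n 1 1≤n ÷ 𝒜 [ 𝒜#0 ] - a n 0 z≤n)) * q ^ k ∎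
          where
          E = a₀ + fromℕ n * r
          K = fromℕ k
          X = x ^ n

      -- Double root with zero ratio

      module ZeroRatio (𝒜≈0 : 𝒜 ≈ 0#) where

        ux+v≈0 : u * x + v ≈ 0#
        ux+v≈0 = *-cancelʳ-#0 2#0 (trans ux+v*2≈𝒜 (trans 𝒜≈0 (sym (zeroˡ 2#))))

        -- All of u a n 0 + v a (n - 1) 0 carries the factor u x + v = 0, except the contribution of
        -- the increment `r` between the two rows.
        first-column-geometric : ∀ n (1≤n : 1 ℕ.≤ n) → a n 1 1≤n ≈ u * r * x ^ n
        first-column-geometric (suc n) 1≤n = begin
          a (suc n) 1 1≤n
            ≈⟨ entry-step n 0 1≤n ⟩
          u * a (suc n) 0 z≤n + v * a n 0 z≤n
            ≈⟨ +-cong (*-congˡ (diagonal-closed (suc n))) (*-congˡ (diagonal-closed n)) ⟩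
          u * ((a₀ + (1# + N) * r) * (x * X)) + v * ((a₀ + N * r) * X)
            ≈⟨ solve 7 (λ u v y N r x X →
                 u :* ((y :+ (:1 :+ N) :* r) :* (x :* X)) :+ v :* ((y :+ N :* r) :* X) :=
                 u :* r :* (x :* X) :+ (y :+ N :* r) :* X :* (u :* x :+ v :- :0))
                 refl u v a₀ N r x X ⟩
          u * r * (x * X) + (a₀ + N * r) * X * (u * x + v - 0#)
            ≈⟨ vanish _ ux+v≈0 ⟩
          u * r * (x * X) ∎
          where
          N = fromℕ n
          X = x ^ n

        -- Column 2 vanishes because column 1 is a multiple of xⁿ from row 1 on; later columns
        -- combine zeros. The shift of both indices by two encodes 2 ≤ k ≤ n.
        entry-vanishes : ∀ n k .(k≤n : k ℕ.≤ n) →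
          a (suc (suc n)) (suc (suc k)) (s≤s (s≤s k≤n)) ≈ 0#
        entry-vanishes n zero k≤n = begin
          a (suc (suc n)) 2 _
            ≈⟨ entry-step (suc n) 1 (s≤s (s≤s z≤n)) ⟩
          u * a (suc (suc n)) 1 _ + v * a (suc n) 1 _
            ≈⟨ +-cong (*-congˡ (first-column-geometric (suc (suc n)) (s≤s z≤n)))
                      (*-congˡ (first-column-geometric (suc n) (s≤s z≤n))) ⟩
          u * (u * r * (x * X)) + v * (u * r * X)
            ≈⟨ solve 5 (λ u v r x X → u :* (u :* r :* (x :* X)) :+ v :* (u :* r :* X) :=
                 :0 :+ u :* r :* X :* (u :* x :+ v :- :0)) refl u v r x X ⟩
          0# + u * r * X * (u * x + v - 0#)
            ≈⟨ vanish _ ux+v≈0 ⟩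
          0# ∎
          where
          X = x ^ suc n
        entry-vanishes zero (suc k) ()
        entry-vanishes (suc n) (suc k) k<n = begin
          a (suc (suc (suc n))) (suc (suc (suc k))) _
            ≈⟨ entry-step (suc (suc n)) (suc (suc k)) (s≤s (s≤s k<n)) ⟩
          u * a (suc (suc (suc n))) (suc (suc k)) _ + v * a (suc (suc n)) (suc (suc k)) _
            ≈⟨ +-cong (*-congˡ (entry-vanishes (suc n) k (ℕ.<⇒≤ k<n)))
                      (*-congˡ (entry-vanishes n k (s≤s⁻¹ k<n))) ⟩
          u * 0# + v * 0#
            ≈⟨ solve 2 (λ u v → u :* :0 :+ v :* :0 := :0) refl u v ⟩
          0# ∎

-- Passage between ℝ and ℂ

module RealTriangle (R : RealNumbers c ℓ₁ ℓ₂) where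

  open RealNumbers R
  open Complex R
  open IntegerCoefficients commutativeRing

  ι-cong : ∀ {x y} → x ≈ y → ι x ℂ.≈ ι y
  ι-cong x≈y = x≈y , refl

  ι-homo-+ : ∀ x y → ι (x + y) ℂ.≈ ι x ℂ.+ ι y
  ι-homo-+ x y = refl , sym (+-identityˡ 0#)

  ι-homo-* : ∀ x y → ι (x * y) ℂ.≈ ι x ℂ.* ι y
  ι-homo-* x y =
    solve 2 (λ x y → x :* y := x :* y :- :0 :* :0) refl x y ,
    solve 2 (λ x y → :0 := x :* :0 :+ :0 :* y) refl x y

  -- Both recurrences of the triangle have this shape, so `ι` carries the real triangle to a complex
  -- one.
  ι-homo-combination : ∀ p x q y → ι (p * x + q * y) ℂ.≈ ι p ℂ.* ι x ℂ.+ ι q ℂ.* ι y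
  ι-homo-combination p x q y =
    ℂ.trans (ι-homo-+ (p * x) (q * y)) (ℂ.+-cong (ι-homo-* p x) (ι-homo-* q y))

  -- The imaginary part of `ℂ.4#` is a sum of zeros, equal to `0#` but not by computation.
  ι-4# : ι 4# ℂ.≈ ℂ.4#
  ι-4# = refl , solve 0 (:0 := :0 :+ (:0 :+ (:0 :+ (:0 :+ :0)))) refl

  x^2≈x*x : ∀ x → x ^ 2 ≈ x * x
  x^2≈x*x x = *-congˡ (*-identityʳ x)

  z^2≈z*z : ∀ z → z ℂ.^ 2 ℂ.≈ z ℂ.* z
  z^2≈z*z z = ℂ.*-congˡ (ℂ.*-identityʳ z)

  module _ (α β : Carrier) (D : ℂ.Carrier)
           (D²≈α²+4β : D ℂ.^ 2 ℂ.≈ ι (α ^ 2 + 4# * β)) where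

    discriminantᶜ : D ℂ.* D ℂ.≈ ι α ℂ.* ι α ℂ.+ ℂ.4# ℂ.* ι β
    discriminantᶜ = begin
      D ℂ.* D                             ≈⟨ z^2≈z*z D ⟨
      D ℂ.^ 2                             ≈⟨ D²≈α²+4β ⟩
      ι (α ^ 2 + 4# * β)                  ≈⟨ ι-cong (+-congʳ (x^2≈x*x α)) ⟩
      ι (α * α + 4# * β)                  ≈⟨ ι-homo-combination α α 4# β ⟩
      ι α ℂ.* ι α ℂ.+ ι 4# ℂ.* ι β        ≈⟨ ℂ.+-congˡ {ι α ℂ.* ι α} (ℂ.*-congʳ {ι β} ι-4#) ⟩
      ι α ℂ.* ι α ℂ.+ ℂ.4# ℂ.* ι β        ∎
      where open SetoidReasoning ℂ.setoid

    -- The real part of the complex equation brings the vanishing back to ℝ, where the double-root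
    -- case is treated.
    discriminant≈0 : D ℂ.≈ ℂ.0# → α * α + 4# * β ≈ 0#
    discriminant≈0 D≈0 = proj₁ (begin
      ι (α * α + 4# * β)    ≈⟨ ι-cong (+-congʳ (x^2≈x*x α)) ⟨
      ι (α ^ 2 + 4# * β)    ≈⟨ D²≈α²+4β ⟨
      D ℂ.* (D ℂ.^ 1)       ≈⟨ ℂ.*-congʳ {D ℂ.^ 1} D≈0 ⟩
      ℂ.0# ℂ.* (D ℂ.^ 1)    ≈⟨ ℂ.zeroˡ (D ℂ.^ 1) ⟩
      ℂ.0#                  ∎)
      where open SetoidReasoning ℂ.setoid

-- The three cases for the real triangle

module _ {c ℓ₁ ℓ₂} (R : RealNumbers c ℓ₁ ℓ₂) where

  module ℝ = RealNumbers R
  open Complex R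
  open RealTriangle R

  -- Abstract in the apartness proofs, which are large terms in complexField: with
  -- variables in their place the formulas are cheap to compare with the general ones.
  record DistinctRootFormulas
    (a₀ a₁ α β u v : ℝ.Carrier) (D : ℂ.Carrier)
    (2≠0 : ℂ.2# ℂ.# ℂ.0#) (β≠0 : ι β ℂ.# ℂ.0#)
    (2D≠0 : ℂ.2# ℂ.* D ℂ.# ℂ.0#) (2vD≠0 : ℂ.2# ℂ.* ι v ℂ.* D ℂ.# ℂ.0#) : Set ℓ₁ where
    field
      formulas :
        let open ℂ
            aᶜ : ∀ n k → .(k ℕ.≤ n) → Carrier
            aᶜ n k k≤n = ι (Triangle.entry R a₀ a₁ α β u v n k k≤n)
            a₀ᶜ = ι a₀
            a₁ᶜ = ι a₁
            αᶜ = ι α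
            βᶜ = ι β
            uᶜ = ι u
            vᶜ = ι v
            x₁ = (αᶜ + D) ÷ 2# [ 2≠0 ]
            x₂ = (αᶜ - D) ÷ 2# [ 2≠0 ]
        in
        ( ∀ n k (1≤n : 1 ℕ.≤ n) (k≤n : k ℕ.≤ n) →
          aᶜ n k k≤n ≈
            ((vᶜ * D + αᶜ * vᶜ - 2# * βᶜ * uᶜ) * aᶜ n 0 z≤n + 2# * βᶜ * aᶜ n 1 1≤n)
              ÷ 2# * vᶜ * D [ 2vD≠0 ]
              * ((βᶜ * uᶜ - vᶜ * x₂) ÷ βᶜ [ β≠0 ]) ^ k
            + ((vᶜ * D - αᶜ * vᶜ + 2# * βᶜ * uᶜ) * aᶜ n 0 z≤n - 2# * βᶜ * aᶜ n 1 1≤n)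
              ÷ 2# * vᶜ * D [ 2vD≠0 ]
              * ((βᶜ * uᶜ - vᶜ * x₁) ÷ βᶜ [ β≠0 ]) ^ k )
        ×
        ( ∀ n →
          aᶜ n 0 z≤n ≈
            ((D - αᶜ) * a₀ᶜ + 2# * a₁ᶜ) ÷ 2# * D [ 2D≠0 ] * x₁ ^ n
            + ((D + αᶜ) * a₀ᶜ - 2# * a₁ᶜ) ÷ 2# * D [ 2D≠0 ] * x₂ ^ n )
        ×
        ( ∀ n (1≤n : 1 ℕ.≤ n) →
          aᶜ n 1 1≤n ≈
            ((D - αᶜ) * a₀ᶜ + 2# * a₁ᶜ) ÷ 2# * D [ 2D≠0 ]
              * x₁ ^ (n ∸ 1) * (uᶜ * x₁ + vᶜ)
            + ((D + αᶜ) * a₀ᶜ - 2# * a₁ᶜ) ÷ 2# * D [ 2D≠0 ]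
              * x₂ ^ (n ∸ 1) * (uᶜ * x₂ + vᶜ) )

  open DistinctRootFormulas

  distinctRootFormulas : ∀ {a₀ a₁ α β u v D 2≠0 β≠0 2D≠0 2vD≠0} →
    D ℂ.^ 2 ℂ.≈ ι (α ℝ.^ 2 ℝ.+ ℝ.4# ℝ.* β) →
    DistinctRootFormulas a₀ a₁ α β u v D 2≠0 β≠0 2D≠0 2vD≠0
  distinctRootFormulas {a₀} {a₁} {α} {β} {u} {v} {D} {2≠0} {β≠0} {2D≠0} {2vD≠0}
    D²≈α²+4β .formulas =
      (λ n k 1≤n k≤n →
        T.entry-closed
          {N₁ n 1≤n ÷ 2# * vᶜ * D [ 2vD≠0 ]} {N₂ n 1≤n ÷ 2# * vᶜ * D [ 2vD≠0 ]}
          n k 1≤n k≤n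
          (÷-*-cancel _ (2# * vᶜ * D) 2vD≠0) (÷-*-cancel _ (2# * vᶜ * D) 2vD≠0))
    , T.diagonal-closed
    , T.first-column-closed
    where
    open ℂ
    open FieldTheory complexField using (÷-*-cancel; module TriangleOver)
    a₀ᶜ = ι a₀
    a₁ᶜ = ι a₁
    αᶜ = ι α
    βᶜ = ι β
    uᶜ = ι u
    vᶜ = ι v
    x₁ = (αᶜ + D) ÷ 2# [ 2≠0 ]
    x₂ = (αᶜ - D) ÷ 2# [ 2≠0 ]

    aᶜ : ∀ n k → .(k ℕ.≤ n) → Carrier
    aᶜ n k k≤n = ι (Triangle.entry R a₀ a₁ α β u v n k k≤n)

    N₁ N₂ : ∀ n → 1 ℕ.≤ n → Carrier
    N₁ n 1≤n = (vᶜ * D + αᶜ * vᶜ - 2# * βᶜ * uᶜ) * aᶜ n 0 z≤n + 2# * βᶜ * aᶜ n 1 1≤n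
    N₂ n 1≤n = (vᶜ * D - αᶜ * vᶜ + 2# * βᶜ * uᶜ) * aᶜ n 0 z≤n - 2# * βᶜ * aᶜ n 1 1≤n

    -- The general result is applied to the image of the real triangle in ℂ; cancelling each
    -- quotient against its denominator supplies the cleared equations.
    module T = TriangleOver.DistinctRoots αᶜ βᶜ uᶜ vᶜ aᶜ
      (λ _ → ι-homo-combination _ _ _ _) (λ _ _ _ → ι-homo-combination _ _ _ _)
      {D} {x₁} {x₂}
      {(βᶜ * uᶜ - vᶜ * x₂) ÷ βᶜ [ β≠0 ]}
      {(βᶜ * uᶜ - vᶜ * x₁) ÷ βᶜ [ β≠0 ]}
      {((D - αᶜ) * a₀ᶜ + 2# * a₁ᶜ) ÷ 2# * D [ 2D≠0 ]}
      {((D + αᶜ) * a₀ᶜ - 2# * a₁ᶜ) ÷ 2# * D [ 2D≠0 ]}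
      2≠0 β≠0 2D≠0 2vD≠0 (discriminantᶜ α β D D²≈α²+4β)
      (÷-*-cancel _ 2# 2≠0) (÷-*-cancel _ 2# 2≠0)
      (÷-*-cancel _ βᶜ β≠0) (÷-*-cancel _ βᶜ β≠0)
      (÷-*-cancel _ (2# * D) 2D≠0) (÷-*-cancel _ (2# * D) 2D≠0)

  -- Specialises to concrete apartness proofs derived from those for αβ, uv and D, while the
  -- formulas are still wrapped in the record type.
  distinctRootFormulas-D≠0 : ∀ a₀ a₁ α β u v D
    (αβ≠0 : α ℝ.* β ℝ.# ℝ.0#) (uv≠0 : u ℝ.* v ℝ.# ℝ.0#) (D≠0 : D ℂ.# ℂ.0#) →
    D ℂ.^ 2 ℂ.≈ ι (α ℝ.^ 2 ℝ.+ ℝ.4# ℝ.* β) →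
    let open ℂ
        β≠0 = ℝ.*#0⇒ʳ#0 αβ≠0
        v≠0 = ℝ.*#0⇒ʳ#0 uv≠0
        2D≠0 = *#0 2ᶜ#0 D≠0
        2vD≠0 = *#0 (*#0 2ᶜ#0 (ι-#0 v≠0)) D≠0
    in
    DistinctRootFormulas a₀ a₁ α β u v D 2ᶜ#0 (ι-#0 β≠0) 2D≠0 2vD≠0
  distinctRootFormulas-D≠0 _ _ _ _ _ _ _ _ _ _ D²≈α²+4β = distinctRootFormulas D²≈α²+4β

  theorem11 :
    (a₀ a₁ α β u v : ℝ.Carrier)
    (αβ≠0 : α ℝ.* β ℝ.# ℝ.0#)
    (uv≠0 : u ℝ.* v ℝ.# ℝ.0#)
    (a₀a₁≠0 : ℝ.∣ a₀ ∣ ℝ.+ ℝ.∣ a₁ ∣ ℝ.# ℝ.0#)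
    (D : ℂ.Carrier)
    (D²≈α²+4β : D ℂ.^ 2 ℂ.≈ ι (α ℝ.^ 2 ℝ.+ ℝ.4# ℝ.* β)) →
    let a : ∀ n k → .(k ℕ.≤ n) → ℝ.Carrier
        a = Triangle.entry R a₀ a₁ α β u v
        𝒜 = u ℝ.* α ℝ.+ ℝ.2# ℝ.* v
        α≠0 = ℝ.*#0⇒ˡ#0 αβ≠0
        β≠0 = ℝ.*#0⇒ʳ#0 αβ≠0
        v≠0 = ℝ.*#0⇒ʳ#0 uv≠0
    in
    -- (1)
    ( (D≠0 : D ℂ.# ℂ.0#) →
      let open ℂ
          aᶜ : ∀ n k → .(k ℕ.≤ n) → Carrier
          aᶜ n k k≤n = ι (a n k k≤n)
          a₀ᶜ = ι a₀
          a₁ᶜ = ι a₁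
          αᶜ = ι α
          βᶜ = ι β
          uᶜ = ι u
          vᶜ = ι v
          2D≠0 = *#0 2ᶜ#0 D≠0
          2vD≠0 = *#0 (*#0 2ᶜ#0 (ι-#0 v≠0)) D≠0
          x₁ = (αᶜ + D) ÷ 2# [ 2ᶜ#0 ]
          x₂ = (αᶜ - D) ÷ 2# [ 2ᶜ#0 ]
      in
      ( ∀ n k (1≤n : 1 ℕ.≤ n) (k≤n : k ℕ.≤ n) →
        aᶜ n k k≤n ≈
          ((vᶜ * D + αᶜ * vᶜ - 2# * βᶜ * uᶜ) * aᶜ n 0 z≤n + 2# * βᶜ * aᶜ n 1 1≤n)
            ÷ 2# * vᶜ * D [ 2vD≠0 ]
            * ((βᶜ * uᶜ - vᶜ * x₂) ÷ βᶜ [ ι-#0 β≠0 ]) ^ k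
          + ((vᶜ * D - αᶜ * vᶜ + 2# * βᶜ * uᶜ) * aᶜ n 0 z≤n - 2# * βᶜ * aᶜ n 1 1≤n)
            ÷ 2# * vᶜ * D [ 2vD≠0 ]
            * ((βᶜ * uᶜ - vᶜ * x₁) ÷ βᶜ [ ι-#0 β≠0 ]) ^ k )
      ×
      ( ∀ n →
        aᶜ n 0 z≤n ≈
          ((D - αᶜ) * a₀ᶜ + 2# * a₁ᶜ) ÷ 2# * D [ 2D≠0 ] * x₁ ^ n
          + ((D + αᶜ) * a₀ᶜ - 2# * a₁ᶜ) ÷ 2# * D [ 2D≠0 ] * x₂ ^ n )
      ×
      ( ∀ n (1≤n : 1 ℕ.≤ n) →
        aᶜ n 1 1≤n ≈
          ((D - αᶜ) * a₀ᶜ + 2# * a₁ᶜ) ÷ 2# * D [ 2D≠0 ]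
            * x₁ ^ (n ∸ 1) * (uᶜ * x₁ + vᶜ)
          + ((D + αᶜ) * a₀ᶜ - 2# * a₁ᶜ) ÷ 2# * D [ 2D≠0 ]
            * x₂ ^ (n ∸ 1) * (uᶜ * x₂ + vᶜ) ) )
    ×
    -- (2)
    ( D ℂ.≈ ℂ.0# → (𝒜≠0 : 𝒜 ℝ.# ℝ.0#) →
      let open ℝ in
      ( ∀ n k (1≤n : 1 ℕ.≤ n) (k≤n : k ℕ.≤ n) →
        a n k k≤n ≈
          (a n 0 z≤n + fromℕ k * (α * a n 1 1≤n ÷ 𝒜 [ 𝒜≠0 ] - a n 0 z≤n))
            * (𝒜 ÷ α [ α≠0 ]) ^ k )
      ×
      ( ∀ n →
        a n 0 z≤n ≈
          (a₀ + fromℕ n * ((2# * a₁ - α * a₀) ÷ α [ α≠0 ]))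
            * (α ÷ 2# [ 2#0 ]) ^ n )
      ×
      ( ∀ n (1≤n : 1 ℕ.≤ n) →
        a n 1 1≤n ≈
          u * a n 0 z≤n
          + v * (a₀ + fromℕ (n ∸ 1) * ((2# * a₁ - α * a₀) ÷ α [ α≠0 ]))
              * (α ÷ 2# [ 2#0 ]) ^ (n ∸ 1) ) )
    ×
    -- (3)
    ( D ℂ.≈ ℂ.0# → 𝒜 ℝ.≈ ℝ.0# →
      let open ℝ in
      ( ∀ n →
        a n 0 z≤n ≈
          (a₀ + fromℕ n * ((2# * a₁ - α * a₀) ÷ α [ α≠0 ]))
            * (α ÷ 2# [ 2#0 ]) ^ n )
      ×
      ( ∀ n (1≤n : 1 ℕ.≤ n) →
        a n 1 1≤n ≈
          u * ((2# * a₁ - α * a₀) ÷ α [ α≠0 ]) * (α ÷ 2# [ 2#0 ]) ^ n )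
      ×
      ( ∀ n k (2≤k : 2 ℕ.≤ k) (k≤n : k ℕ.≤ n) → a n k k≤n ≈ 0# ) )
  theorem11 a₀ a₁ α β u v αβ≠0 uv≠0 _ D D²≈α²+4β =
      (λ D≠0 →
        let record { formulas = f } =
              distinctRootFormulas-D≠0 a₀ a₁ α β u v D αβ≠0 uv≠0 D≠0 D²≈α²+4β
        in f)
    , (λ D≈0 𝒜≠0 →
        let module S = T.DoubleRoot
              (discriminant≈0 α β D D²≈α²+4β D≈0) 2#0 (ℝ.*#0⇒ˡ#0 αβ≠0)
            module N = S.NonzeroRatio 𝒜≠0
        in N.entry-closed , S.diagonal-closed , S.first-column-closed)
    , (λ D≈0 𝒜≈0 →
        let module S = T.DoubleRoot
              (discriminant≈0 α β D D²≈α²+4β D≈0) 2#0 (ℝ.*#0⇒ˡ#0 αβ≠0)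
            module Z = S.ZeroRatio 𝒜≈0
        in S.diagonal-closed , Z.first-column-geometric
         -- The bounds 2 ≤ k ≤ n force both indices to be at least two, so one pattern is
         -- exhaustive.
         , λ { (suc (suc n)) (suc (suc k)) (s≤s (s≤s _)) (s≤s (s≤s k≤n)) →
               Z.entry-vanishes n k k≤n })
    where
    -- Over ℝ both recurrences hold by definition of the triangle.
    module T = FieldTheory.TriangleOver ℝ.heytingField α β u v
      (Triangle.entry R a₀ a₁ α β u v) (λ _ → ℝ.refl) (λ _ _ _ → ℝ.refl)
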